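{- For any $\epsilon>0$ (not necessarily a constant), any one-dimensional $(1+\epsilon)$-approximate range mode data structure for sequences of length $n$ requires $\Omega(n/(1+\epsilon))$ bits of space in the worst case.
   Context: Let $c_1,\dots,c_n$ be a sequence of elements (also called colors; no bound on the number of distinct colors is assumed). For $1\le a\le b\le n$ write $c_{a..b}$ for $c_a,\dots,c_b$, let $F_x(c_{a..b})$ be the number of occurrences of the element $x$ in $c_{a..b}$, and $F(c_{a..b})=\max_x F_x(c_{a..b})$. For $\epsilon>0$, a $(1+\epsilon)$-approximate range mode query is given indices $a\le b$ and asks for the position (an index in $[a,b]$) of an element $x$ of $c_{a..b}$ with $(1+\epsilon)\cdot F_x(c_{a..b})\ge F(c_{a..b})$. A one-dimensional $(1+\epsilon)$-approximate range mode data structure is a map assigning to each sequence of length $n$ a bit string (its encoding), together with a query algorithm which, given only this bit string and a pair $(a,b)$ (and without access to the original sequence), correctly answers every $(1+\epsilon)$-approximate range mode query on the sequence. Its space is the maximum length in bits of the encoding over all sequences of length $n$. The notation $\Omega(n/(1+\epsilon))$ means that the space is bounded below by an absolute positive constant times $n/(1+\epsilon)$, as an asymptotic statement for $n/(1+\epsilon)$ sufficiently large. -}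

module Defs where

open import Algebra.Bundles using (module CommutativeMonoid)
open import Data.Bool using (Bool)
open import Data.Fin as Fin using (Fin; toℕ)
open import Data.Integer as ℤ using ()
open import Data.List using (List; drop; filter; length; map; take)
open import Data.List.Extrema.Nat using (max)
open import Data.Nat as ℕ using (ℕ; suc)
import Data.Nat.Properties as ℕ
open import Data.Product using (∃-syntax; _×_; _,_)
open import Data.Rational as ℚ using (ℚ; 0ℚ; 1ℚ; ½; ∣_∣)
open import Data.Rational.Properties
open import Data.Vec using (Vec; lookup; toList)
open import Relation.Binary.PropositionalEquality using (_≡_; cong; cong₂; sym; module ≡-Reasoning)

------------------------------------------------------------------------
-- Real numbers: Cauchy sequences of rationals with a modulus of
-- convergence.  Equality of reals is x ≤ y together with y ≤ x, never
-- propositional equality of representatives.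

IsCauchy : (ℕ → ℚ) → Set
IsCauchy s = ∀ δ → 0ℚ ℚ.< δ →
  ∃[ N ] ∀ m n → N ℕ.≤ m → N ℕ.≤ n → ∣ s m ℚ.- s n ∣ ℚ.≤ δ

private
  module RationalLemmas where
    open import Data.Rational
    open import Algebra.Properties.CommutativeSemigroup
      (CommutativeMonoid.commutativeSemigroup +-0-commutativeMonoid) using (interchange)
    open import Algebra.Properties.Group +-0-group using (//-rightDividesˡ)

    half : ∀ {δ} → 0ℚ < δ → 0ℚ < ½ * δ
    half {δ} 0<δ = positive⁻¹ _ {{pos*pos⇒pos ½ δ {{positive 0<δ}}}}

    halves : ∀ δ → ½ * δ + ½ * δ ≡ δ
    halves δ = begin
      ½ * δ + ½ * δ  ≡⟨ *-distribʳ-+ δ ½ ½ ⟨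
      1ℚ * δ         ≡⟨ *-identityˡ δ ⟩
      δ              ∎
      where open ≡-Reasoning

    split : ∀ a b → a ≡ (a - b) + b
    split a b = sym (//-rightDividesˡ b a)

    telescope : ∀ a b c → a - c ≡ (a - b) + (b - c)
    telescope a b c = begin
      a - c              ≡⟨ cong (_- c) (split a b) ⟩
      (a - b) + b - c    ≡⟨ +-assoc (a - b) b (- c) ⟩
      (a - b) + (b - c)  ∎
      where open ≡-Reasoning

    +-diff : ∀ a b c d → (a + b) - (c + d) ≡ (a - c) + (b - d)
    +-diff a b c d = begin
      (a + b) - (c + d)      ≡⟨ cong (a + b +_) (neg-distrib-+ c d) ⟩
      (a + b) + (- c + - d)  ≡⟨ interchange a b (- c) (- d) ⟩
      (a - c) + (b - d)      ∎
      where open ≡-Reasoning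

    *-diff : ∀ a b c d → a * b - c * d ≡ (a - c) * b + c * (b - d)
    *-diff a b c d = begin
      a * b - c * d
        ≡⟨ telescope (a * b) (c * b) (c * d) ⟩
      (a * b - c * b) + (c * b - c * d)
        ≡⟨ cong₂ (λ x y → (a * b + x) + (c * b + y)) (neg-distribˡ-* c b) (neg-distribʳ-* c d) ⟩
      (a * b + - c * b) + (c * b + c * - d)
        ≡⟨ cong₂ _+_ (*-distribʳ-+ b a (- c)) (*-distribˡ-+ c b (- d)) ⟨
      (a - c) * b + c * (b - d) ∎
      where open ≡-Reasoning

    ∣p*q∣-bound : ∀ p q {r s} → ∣ p ∣ ≤ r → ∣ q ∣ ≤ s → ∣ p * q ∣ ≤ r * s
    ∣p*q∣-bound p q {r} {s} p≤r q≤s = begin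
      ∣ p * q ∣      ≡⟨ ∣p*q∣≡∣p∣*∣q∣ p q ⟩
      ∣ p ∣ * ∣ q ∣  ≤⟨ *-monoˡ-≤-nonNeg ∣ p ∣ {{nonNegative (0≤∣p∣ p)}} q≤s ⟩
      ∣ p ∣ * s      ≤⟨ *-monoʳ-≤-nonNeg s {{nonNegative (≤-trans (0≤∣p∣ q) q≤s)}} p≤r ⟩
      r * s          ∎
      where open ≤-Reasoning

    divide : ∀ {δ} → 0ℚ < δ → ∀ B → Positive B → ∃[ η ] 0ℚ < η × B * η ≡ δ
    divide {δ} 0<δ B B>0 = B⁻¹ * δ , 0<B⁻¹δ , (begin
      B * (B⁻¹ * δ)  ≡⟨ *-assoc B B⁻¹ δ ⟨
      (B * B⁻¹) * δ  ≡⟨ cong (_* δ) (*-inverseʳ B {{B≢0}}) ⟩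
      1ℚ * δ         ≡⟨ *-identityˡ δ ⟩
      δ              ∎)
      where
      open ≡-Reasoning
      B≢0 = pos⇒nonZero B {{B>0}}
      B⁻¹ = (1/ B) {{B≢0}}
      0<B⁻¹δ = positive⁻¹ _ {{pos*pos⇒pos B⁻¹ {{1/pos⇒pos B {{B>0}}}} δ {{positive 0<δ}}}}

    bounded : ∀ s → IsCauchy s →
      ∃[ B ] Positive B × (∃[ N ] ∀ n → N ℕ.≤ n → ∣ s n ∣ ≤ B)
    bounded s cs with cs 1ℚ (positive⁻¹ 1ℚ)
    ... | N , h = 1ℚ + ∣ s N ∣
                , pos+nonNeg⇒pos 1ℚ ∣ s N ∣ {{nonNegative (0≤∣p∣ (s N))}}
                , N , λ n n≥ → begin
      ∣ s n ∣                 ≡⟨ cong ∣_∣ (split (s n) (s N)) ⟩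
      ∣ (s n - s N) + s N ∣   ≤⟨ ∣p+q∣≤∣p∣+∣q∣ (s n - s N) (s N) ⟩
      ∣ s n - s N ∣ + ∣ s N ∣ ≤⟨ +-monoˡ-≤ ∣ s N ∣ (h n N n≥ ℕ.≤-refl) ⟩
      1ℚ + ∣ s N ∣            ∎
      where open ≤-Reasoning

    +-cauchy : ∀ s t → IsCauchy s → IsCauchy t → IsCauchy (λ n → s n + t n)
    +-cauchy s t cs ct δ 0<δ with cs (½ * δ) (half 0<δ) | ct (½ * δ) (half 0<δ)
    ... | M , hs | N , ht = M ℕ.⊔ N , λ m n m≥ n≥ → begin
      ∣ (s m + t m) - (s n + t n) ∣
        ≡⟨ cong ∣_∣ (+-diff (s m) (t m) (s n) (t n)) ⟩
      ∣ (s m - s n) + (t m - t n) ∣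
        ≤⟨ ∣p+q∣≤∣p∣+∣q∣ (s m - s n) (t m - t n) ⟩
      ∣ s m - s n ∣ + ∣ t m - t n ∣
        ≤⟨ +-mono-≤ (hs m n (ℕ.m⊔n≤o⇒m≤o M N m≥) (ℕ.m⊔n≤o⇒m≤o M N n≥))
                    (ht m n (ℕ.m⊔n≤o⇒n≤o M N m≥) (ℕ.m⊔n≤o⇒n≤o M N n≥)) ⟩
      ½ * δ + ½ * δ
        ≡⟨ halves δ ⟩
      δ ∎
      where open ≤-Reasoning

    *-cauchy : ∀ s t → IsCauchy s → IsCauchy t → IsCauchy (λ n → s n * t n)
    *-cauchy s t cs ct δ 0<δ
      with bounded s cs | bounded t ct
    ... | A , A>0 , M , hA | B , B>0 , N , hB
      with divide (half 0<δ) B B>0 | divide (half 0<δ) A A>0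
    ... | α , 0<α , Bα≡½δ | β , 0<β , Aβ≡½δ
      with cs α 0<α | ct β 0<β
    ... | P , hs | Q , ht = (M ℕ.⊔ N) ℕ.⊔ (P ℕ.⊔ Q) , λ m n m≥ n≥ →
      let n≥MN = ℕ.m⊔n≤o⇒m≤o (M ℕ.⊔ N) (P ℕ.⊔ Q) n≥
          m≥MN = ℕ.m⊔n≤o⇒m≤o (M ℕ.⊔ N) (P ℕ.⊔ Q) m≥
          m≥PQ = ℕ.m⊔n≤o⇒n≤o (M ℕ.⊔ N) (P ℕ.⊔ Q) m≥
          n≥PQ = ℕ.m⊔n≤o⇒n≤o (M ℕ.⊔ N) (P ℕ.⊔ Q) n≥
      in begin
      ∣ s m * t m - s n * t n ∣
        ≡⟨ cong ∣_∣ (*-diff (s m) (t m) (s n) (t n)) ⟩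
      ∣ (s m - s n) * t m + s n * (t m - t n) ∣
        ≤⟨ ∣p+q∣≤∣p∣+∣q∣ ((s m - s n) * t m) (s n * (t m - t n)) ⟩
      ∣ (s m - s n) * t m ∣ + ∣ s n * (t m - t n) ∣
        ≤⟨ +-mono-≤
             (∣p*q∣-bound (s m - s n) (t m)
               (hs m n (ℕ.m⊔n≤o⇒m≤o P Q m≥PQ) (ℕ.m⊔n≤o⇒m≤o P Q n≥PQ))
               (hB m (ℕ.m⊔n≤o⇒n≤o M N m≥MN)))
             (∣p*q∣-bound (s n) (t m - t n)
               (hA n (ℕ.m⊔n≤o⇒m≤o M N n≥MN))
               (ht m n (ℕ.m⊔n≤o⇒n≤o P Q m≥PQ) (ℕ.m⊔n≤o⇒n≤o P Q n≥PQ))) ⟩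
      α * B + A * β
        ≡⟨ cong (_+ A * β) (*-comm α B) ⟩
      B * α + A * β
        ≡⟨ cong₂ _+_ Bα≡½δ Aβ≡½δ ⟩
      ½ * δ + ½ * δ
        ≡⟨ halves δ ⟩
      δ ∎
      where open ≤-Reasoning

  open RationalLemmas using (+-cauchy; *-cauchy)

record ℝ : Set where
  constructor mkℝ
  field
    seq    : ℕ → ℚ
    cauchy : IsCauchy seq

open ℝ public

infix 4 _≤_ _<_

_≤_ : ℝ → ℝ → Set
x ≤ y = ∀ δ → 0ℚ ℚ.< δ → ∃[ N ] ∀ n → N ℕ.≤ n → seq x n ℚ.≤ seq y n ℚ.+ δ

_<_ : ℝ → ℝ → Set
x < y = ∃[ δ ] 0ℚ ℚ.< δ × (∃[ N ] ∀ n → N ℕ.≤ n → seq x n ℚ.+ δ ℚ.≤ seq y n)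

fromℚ : ℚ → ℝ
fromℚ q = mkℝ (λ _ → q) λ δ 0<δ → 0 , λ _ _ _ _ → begin
  ∣ q ℚ.- q ∣  ≡⟨ cong ∣_∣ (+-inverseʳ q) ⟩
  0ℚ           <⟨ 0<δ ⟩
  δ            ∎
  where open ≤-Reasoning

fromℕ : ℕ → ℝ
fromℕ k = fromℚ (ℤ.+ k ℚ./ 1)

infixl 6 _+_
infixl 7 _*_

_+_ : ℝ → ℝ → ℝ
x + y = mkℝ (λ n → seq x n ℚ.+ seq y n) (+-cauchy (seq x) (seq y) (cauchy x) (cauchy y))

_*_ : ℝ → ℝ → ℝ
x * y = mkℝ (λ n → seq x n ℚ.* seq y n) (*-cauchy (seq x) (seq y) (cauchy x) (cauchy y))

0ℝ 1ℝ : ℝ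
0ℝ = fromℚ 0ℚ
1ℝ = fromℚ 1ℚ

------------------------------------------------------------------------
-- Range modes.  Colors are natural numbers, so that the supply of
-- distinct colors is unlimited; positions are 0-based.

Color : Set
Color = ℕ

-- c_a , … , c_b, both ends included.
range : ∀ {n} → Vec Color n → Fin n → Fin n → List Color
range cs a b = drop (toℕ a) (take (suc (toℕ b)) (toList cs))

frequency : Color → List Color → ℕ
frequency x cs = length (filter (ℕ._≟ x) cs)

maxFrequency : List Color → ℕ
maxFrequency cs = max 0 (map (λ x → frequency x cs) cs)

record IsApproxMode (ε : ℝ) {n} (cs : Vec Color n) (a b p : Fin n) : Set where
  field
    lower  : a Fin.≤ p
    upper  : p Fin.≤ b
    approx : fromℕ (maxFrequency (range cs a b))
             ≤ (1ℝ + ε) * fromℕ (frequency (lookup cs p) (range cs a b))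

-- `query` sees only the encoding and the two indices; its value is
-- irrelevant when the indices are out of order.
record ApproxRangeModeStructure (ε : ℝ) (n : ℕ) : Set where
  field
    encode  : Vec Color n → List Bool
    query   : List Bool → Fin n → Fin n → Fin n
    correct : ∀ cs a b → a Fin.≤ b → IsApproxMode ε cs a b (query (encode cs) a b)

  spaceFor : Vec Color n → ℕ
  spaceFor cs = length (encode cs)

{-# OPTIONS --safe #-}

-- Take an integer K slightly larger than 1 + ε and cut the sequence into
-- blocks of length 2K.  A bit is stored in a block by giving color 0 to one
-- of its two halves and pairwise distinct colors to the other.  Color 0 then
-- occurs K > 1 + ε times in the block and every other color at most once, so
-- any approximate mode of the block reveals the bit.  Hence the encoding
-- determines n / 2K independent bits, and some encoding is at least that long.
module Submission where

open import Data.Nat using (ℕ)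
open import Data.Product using (∃-syntax; _×_)

open import Data.Bool using (Bool; true; false; not; if_then_else_)
open import Data.Fin as Fin using (Fin; toℕ; fromℕ<)
open import Data.Fin.Properties using (toℕ-fromℕ<; toℕ<n)
import Data.Integer as ℤ
import Data.Integer.Properties as ℤ
open import Data.List using (List; []; _∷_; _++_; length; map; take; drop; applyUpTo)
open import Data.List.Extrema.Nat using (xs≤max)
open import Data.List.Membership.Propositional using (_∈_; _∉_)
open import Data.List.Membership.Propositional.Properties using (∈-map⁺; ∈-++⁺ˡ; ∈-++⁺ʳ)
open import Data.List.Properties using (length-map; length-++; filter-accept; filter-reject; filter-none)
import Data.List.Relation.Unary.All as All
open import Data.List.Relation.Unary.All.Properties using (¬Any⇒All¬)
open import Data.List.Relation.Unary.Any using (here; there)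
import Data.Nat as ℕ
import Data.Nat.Coprimality as Coprime
import Data.Nat.DivMod as ℕ
import Data.Nat.Properties as ℕ
open import Data.Product using (_,_; proj₁; proj₂)
open import Data.Rational as ℚ using (ℚ; 0ℚ; 1ℚ; ½)
import Data.Rational.Properties as ℚ
open import Data.Rational.Solver using (module +-*-Solver)
open import Data.Vec using (Vec; []; _∷_; lookup; tabulate; toList)
open import Data.Vec.Properties using (lookup∘tabulate; tabulate-cong; tabulate∘lookup)
open import Function using (_∘_)
open import Relation.Binary.PropositionalEquality
open import Relation.Nullary using (¬_; yes; no; contradiction)

-- Counting bit strings: a decodable code for `m` bits has a codeword of length at least `m`.

module Incompressibility where
  open import Data.Nat

  shorter : ℕ → List (List Bool)
  shorter zero    = []
  shorter (suc m) = [] ∷ map (false ∷_) (shorter m) ++ map (true ∷_) (shorter m)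

  -- Falling one short of `2 ^ m` is exactly what the pigeonhole argument needs; the `suc` on the
  -- left avoids truncated subtraction.
  length-shorter : ∀ m → suc (length (shorter m)) ≡ 2 ^ m
  length-shorter zero    = refl
  length-shorter (suc m) = begin
    2 + length (map (false ∷_) s ++ map (true ∷_) s)
      ≡⟨ cong (2 +_) (length-++ (map (false ∷_) s)) ⟩
    2 + (length (map (false ∷_) s) + length (map (true ∷_) s))
      ≡⟨ cong₂ (λ x y → 2 + (x + y)) (length-map _ s) (length-map _ s) ⟩
    2 + (length s + length s)
      ≡⟨ cong suc (ℕ.+-suc (length s) (length s)) ⟨
    suc (length s) + suc (length s)
      ≡⟨ cong₂ _+_ (length-shorter m) (trans (length-shorter m) (sym (ℕ.+-identityʳ _))) ⟩
    2 ^ suc m ∎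
    where
    open ≡-Reasoning
    s = shorter m

  ∈-shorter : ∀ {m} s → length s < m → s ∈ shorter m
  ∈-shorter []          (s≤s _)   = here refl
  ∈-shorter (false ∷ s) (s≤s s<m) = there (∈-++⁺ˡ (∈-map⁺ _ (∈-shorter s s<m)))
  ∈-shorter (true  ∷ s) (s≤s s<m) = there (∈-++⁺ʳ _ (∈-map⁺ _ (∈-shorter s s<m)))

  tailsAfter : ∀ {m} → Bool → List (Vec Bool (suc m)) → List (Vec Bool m)
  tailsAfter _     []                  = []
  tailsAfter false ((false ∷ v) ∷ vs) = v ∷ tailsAfter false vs
  tailsAfter false ((true  ∷ v) ∷ vs) = tailsAfter false vs
  tailsAfter true  ((false ∷ v) ∷ vs) = tailsAfter true vs
  tailsAfter true  ((true  ∷ v) ∷ vs) = v ∷ tailsAfter true vs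

  length-tailsAfter : ∀ {m} (vs : List (Vec Bool (suc m))) →
    length (tailsAfter false vs) + length (tailsAfter true vs) ≡ length vs
  length-tailsAfter []                  = refl
  length-tailsAfter ((false ∷ v) ∷ vs) = cong suc (length-tailsAfter vs)
  length-tailsAfter ((true  ∷ v) ∷ vs) =
    trans (ℕ.+-suc (length (tailsAfter false vs)) _) (cong suc (length-tailsAfter vs))

  ∈-tailsAfter : ∀ {m} b {v : Vec Bool m} vs → b ∷ v ∈ vs → v ∈ tailsAfter b vs
  ∈-tailsAfter false (_           ∷ vs) (here refl) = here refl
  ∈-tailsAfter true  (_           ∷ vs) (here refl) = here refl
  ∈-tailsAfter false ((false ∷ _) ∷ vs) (there v∈)  = there (∈-tailsAfter false vs v∈)
  ∈-tailsAfter false ((true  ∷ _) ∷ vs) (there v∈)  = ∈-tailsAfter false vs v∈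
  ∈-tailsAfter true  ((false ∷ _) ∷ vs) (there v∈)  = ∈-tailsAfter true vs v∈
  ∈-tailsAfter true  ((true  ∷ _) ∷ vs) (there v∈)  = there (∈-tailsAfter true vs v∈)

  -- Pigeonhole by bisection: grouping the list by first bit leaves fewer than `2 ^ m` tails in one
  -- of the two groups, and a vector missing there, prefixed by that bit, is missing from the whole
  -- list.
  missing : ∀ m (vs : List (Vec Bool m)) → length vs < 2 ^ m → ∃[ v ] v ∉ vs
  missing zero    []      _            = [] , λ ()
  missing zero    (_ ∷ _) (s≤s ())
  missing (suc m) vs      vs<2^1+m with length (tailsAfter false vs) <? 2 ^ m
  ... | yes f<2^m =
    let v , v∉ = missing m (tailsAfter false vs) f<2^m
    in false ∷ v , v∉ ∘ ∈-tailsAfter false vs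
  ... | no f≮2^m =
    let v , v∉ = missing m (tailsAfter true vs) t<2^m
    in true ∷ v , v∉ ∘ ∈-tailsAfter true vs
    where
    open ℕ.≤-Reasoning
    t<2^m : length (tailsAfter true vs) < 2 ^ m
    t<2^m = ℕ.+-cancelˡ-< (2 ^ m) _ _ (begin-strict
      2 ^ m + length (tailsAfter true vs)
        ≤⟨ ℕ.+-monoˡ-≤ _ (ℕ.≮⇒≥ f≮2^m) ⟩
      length (tailsAfter false vs) + length (tailsAfter true vs)
        ≡⟨ length-tailsAfter vs ⟩
      length vs
        <⟨ vs<2^1+m ⟩
      2 ^ m + (2 ^ m + 0)
        ≡⟨ cong (2 ^ m +_) (ℕ.+-identityʳ _) ⟩
      2 ^ m + 2 ^ m ∎)

  -- The strings shorter than `m` decode to fewer than `2 ^ m` vectors. A vector missed by all of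
  -- them cannot have a short encoding, since decoding that encoding returns the vector.
  incompressible : ∀ {m} (enc : Vec Bool m → List Bool) (dec : List Bool → Vec Bool m) →
    (∀ v → dec (enc v) ≡ v) → ∃[ v ] m ≤ length (enc v)
  incompressible {m} enc dec dec∘enc =
    let v , v∉ = missing m (map dec (shorter m)) decoded<2^m
    in v , ℕ.≮⇒≥ λ short →
      v∉ (subst (_∈ map dec (shorter m)) (dec∘enc v) (∈-map⁺ dec (∈-shorter (enc v) short)))
    where
    decoded<2^m : length (map dec (shorter m)) < 2 ^ m
    decoded<2^m rewrite length-map dec (shorter m) = ℕ.≤-reflexive (length-shorter m)

-- Frequencies in lists and in ranges of tabulated sequences.

module Frequencies where
  open import Data.Nat
  open import Defs using (Color; range; frequency; maxFrequency)

  frequency-∷-≡ : ∀ {x y} ys → y ≡ x → frequency x (y ∷ ys) ≡ suc (frequency x ys)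
  frequency-∷-≡ {x} ys y≡x = cong length (filter-accept (_≟ x) y≡x)

  frequency-∷-≢ : ∀ {x y} ys → y ≢ x → frequency x (y ∷ ys) ≡ frequency x ys
  frequency-∷-≢ {x} ys y≢x = cong length (filter-reject (_≟ x) y≢x)

  frequency-∷-≥ : ∀ x y ys → frequency x ys ≤ frequency x (y ∷ ys)
  frequency-∷-≥ x y ys with y ≟ x
  ... | yes y≡x = ℕ.≤-trans (ℕ.n≤1+n _) (ℕ.≤-reflexive (sym (frequency-∷-≡ ys y≡x)))
  ... | no  y≢x = ℕ.≤-reflexive (sym (frequency-∷-≢ ys y≢x))

  frequency-∉ : ∀ {x xs} → x ∉ xs → frequency x xs ≡ 0
  frequency-∉ {x} x∉xs =
    cong length (filter-none (_≟ x) (All.map (_∘ sym) (¬Any⇒All¬ _ x∉xs)))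

  -- `maxFrequency` compares only the colors that occur in the list, so a color that does not occur
  -- needs its own case.
  frequency≤maxFrequency : ∀ x xs → frequency x xs ≤ maxFrequency xs
  frequency≤maxFrequency x xs with x ∈? xs
    where open import Data.List.Membership.DecPropositional _≟_ using (_∈?_)
  ... | yes x∈xs = All.lookup (xs≤max 0 _) (∈-map⁺ (λ y → frequency y xs) x∈xs)
  ... | no  x∉xs rewrite frequency-∉ x∉xs = z≤n

  -- The `o` skipped entries can only raise the count; each of the next `k` entries adds one to it.
  frequency-applyUpTo-≥ : ∀ {x} (f : ℕ → Color) o k l →
    (∀ j → j < k → f (o + j) ≡ x) → o + k ≤ l → k ≤ frequency x (applyUpTo f l)
  frequency-applyUpTo-≥ f zero    zero    l       f≡x o+k≤l       = z≤n
  frequency-applyUpTo-≥ f zero    (suc k) (suc l) f≡x (s≤s o+k≤l)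
    rewrite frequency-∷-≡ (applyUpTo (f ∘ suc) l) (f≡x 0 z<s) =
    s≤s (frequency-applyUpTo-≥ (f ∘ suc) zero k l (λ j → f≡x (suc j) ∘ s≤s) o+k≤l)
  frequency-applyUpTo-≥ {x} f (suc o) k (suc l) f≡x (s≤s o+k≤l) = ℕ.≤-trans
    (frequency-applyUpTo-≥ (f ∘ suc) o k l f≡x o+k≤l)
    (frequency-∷-≥ x (f 0) (applyUpTo (f ∘ suc) l))

  frequency-applyUpTo-none : ∀ {x} (f : ℕ → Color) l →
    (∀ i → f i ≢ x) → frequency x (applyUpTo f l) ≡ 0
  frequency-applyUpTo-none f zero    f≢x = refl
  frequency-applyUpTo-none f (suc l) f≢x = trans
    (frequency-∷-≢ (applyUpTo (f ∘ suc) l) (f≢x 0))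
    (frequency-applyUpTo-none (f ∘ suc) l (f≢x ∘ suc))

  -- Injectivity is asked only on the fibre over `x`, because a block coloring repeats color 0.
  frequency-applyUpTo-unique : ∀ {x} (f : ℕ → Color) l →
    (∀ i j → f i ≡ x → f j ≡ x → i ≡ j) → frequency x (applyUpTo f l) ≤ 1
  frequency-applyUpTo-unique     f zero    unique = z≤n
  frequency-applyUpTo-unique {x} f (suc l) unique with f 0 ≟ x
  ... | yes f0≡x = ℕ.≤-reflexive (trans (frequency-∷-≡ _ f0≡x) (cong suc
    (frequency-applyUpTo-none (f ∘ suc) l λ i fi≡x → contradiction (unique 0 (suc i) f0≡x fi≡x) λ ())))
  ... | no f0≢x = ℕ.≤-trans (ℕ.≤-reflexive (frequency-∷-≢ _ f0≢x))
    (frequency-applyUpTo-unique (f ∘ suc) l λ i j p q → ℕ.suc-injective (unique (suc i) (suc j) p q))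

  toList-tabulate : ∀ (f : ℕ → Color) n → toList (tabulate {n = n} (f ∘ toℕ)) ≡ applyUpTo f n
  toList-tabulate f zero    = refl
  toList-tabulate f (suc n) = cong (f 0 ∷_) (toList-tabulate (f ∘ suc) n)

  take-applyUpTo : ∀ (f : ℕ → Color) {m n} → m ≤ n → take m (applyUpTo f n) ≡ applyUpTo f m
  take-applyUpTo f z≤n       = refl
  take-applyUpTo f (s≤s m≤n) = cong (f 0 ∷_) (take-applyUpTo (f ∘ suc) m≤n)

  drop-applyUpTo : ∀ (f : ℕ → Color) m n → drop m (applyUpTo f (m + n)) ≡ applyUpTo (f ∘ (m +_)) n
  drop-applyUpTo f zero    n = refl
  drop-applyUpTo f (suc m) n = drop-applyUpTo (f ∘ suc) m n

  range-tabulate : ∀ (f : ℕ → Color) {n} (a b : Fin n) l → suc (toℕ b) ≡ toℕ a + l →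
    range (tabulate (f ∘ toℕ)) a b ≡ applyUpTo (f ∘ (toℕ a +_)) l
  range-tabulate f {n} a b l eq = begin
    drop (toℕ a) (take (suc (toℕ b)) (toList (tabulate {n = n} (f ∘ toℕ))))
      ≡⟨ cong (drop (toℕ a) ∘ take (suc (toℕ b))) (toList-tabulate f n) ⟩
    drop (toℕ a) (take (suc (toℕ b)) (applyUpTo f n))
      ≡⟨ cong (drop (toℕ a)) (take-applyUpTo f (toℕ<n b)) ⟩
    drop (toℕ a) (applyUpTo f (suc (toℕ b)))
      ≡⟨ cong (drop (toℕ a) ∘ applyUpTo f) eq ⟩
    drop (toℕ a) (applyUpTo f (toℕ a + l))
      ≡⟨ drop-applyUpTo f (toℕ a) l ⟩
    applyUpTo (f ∘ (toℕ a +_)) l ∎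
    where open ≡-Reasoning

-- Storing a bit vector in blocks and reading it back.

-- The half of length K with index h is [h K , (h + 1) K), and the block i
-- consists of the halves 2i and 2i + 1.
module Blocks where
  open import Data.Nat
  open import Data.Nat.DivMod
  open import Data.Nat.Divisibility using (n∣m*n)
  open import Defs using (Color; range; frequency; maxFrequency)
  open Frequencies

  -- Tells whether half `h` gets color 0: in block `i` this is the even half for the bit `false` and
  -- the odd half for `true`, so the parity of the constant half is the stored bit.
  constant : ∀ {m} → Vec Bool m → ℕ → Bool
  -- Halves past the last block receive distinct colors, like any non-constant half.
  constant []      _             = false
  constant (b ∷ v) 0             = not b
  constant (b ∷ v) 1             = b
  constant (b ∷ v) (suc (suc h)) = constant v h

  odd : ℕ → Bool
  odd zero    = false
  odd (suc h) = not (odd h)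

  constant⇒odd : ∀ {m} (v : Vec Bool m) i h → toℕ i * 2 ≤ h → h < suc (toℕ i) * 2 →
    constant v h ≡ true → odd h ≡ lookup v i
  constant⇒odd (false ∷ v) Fin.zero    0             _ _ _  = refl
  constant⇒odd (b     ∷ v) Fin.zero    1             _ _ eq = sym eq
  constant⇒odd (b     ∷ v) Fin.zero    (suc (suc h)) _ (s≤s (s≤s ())) _
  constant⇒odd (b     ∷ v) (Fin.suc i) (suc (suc h)) (s≤s (s≤s lo)) (s≤s (s≤s hi)) eq
    -- A block is two halves, so the recursion flips the parity twice; splitting on `odd h` lets the
    -- double negation compute.
    with odd h | constant⇒odd v i h lo hi eq
  ... | false | p = p
  ... | true  | p = p

  constantHalf : ∀ {m} (v : Vec Bool m) (i : Fin m) → ∃[ o ] o < 2 × constant v (toℕ i * 2 + o) ≡ true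
  constantHalf (false ∷ v) Fin.zero    = 0 , s≤s z≤n , refl
  constantHalf (true  ∷ v) Fin.zero    = 1 , s≤s (s≤s z≤n) , refl
  constantHalf (b     ∷ v) (Fin.suc i) = constantHalf v i

  module Coloring (k : ℕ) where
    K = suc k

    -- Outside the constant halves the position itself serves as the color, shifted by one to keep
    -- clear of color 0.
    color : ∀ {m} → Vec Bool m → ℕ → Color
    color v p = if constant v (p / K) then 0 else suc p

    sequence : ∀ {m} n → Vec Bool m → Vec Color n
    sequence n v = tabulate (color v ∘ toℕ)

    color-suc : ∀ {m} (v : Vec Bool m) p {q} → color v p ≡ suc q → p ≡ q
    color-suc v p eq with constant v (p / K)
    color-suc v p refl | false = refl

    /-half : ∀ h {j} → j < K → (h * K + j) / K ≡ h
    /-half h {j} j<K = begin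
      (h * K + j) / K    ≡⟨ +-distrib-/-∣ˡ j (n∣m*n h) ⟩
      h * K / K + j / K  ≡⟨ cong₂ _+_ (m*n/n≡m h K) (m<n⇒m/n≡0 j<K) ⟩
      h + 0              ≡⟨ ℕ.+-identityʳ h ⟩
      h                  ∎
      where open ≡-Reasoning

    module Positions {m n : ℕ} (m*2K≤n : m * (2 * K) ≤ n) where

      block≤n : ∀ (i : Fin m) → suc (toℕ i) * (2 * K) ≤ n
      block≤n i = ℕ.≤-trans (ℕ.*-monoˡ-≤ (2 * K) (toℕ<n i)) m*2K≤n

      first<n : ∀ (i : Fin m) → toℕ i * (2 * K) < n
      first<n i = ℕ.≤-trans (s≤s (ℕ.m≤n+m _ _)) (block≤n i)

      first last : Fin m → Fin n
      first i = fromℕ< (first<n i)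
      -- The product in `block≤n i` reduces to a successor, so this is the last position of the
      -- block and not the first one after it.
      last  i = fromℕ< (block≤n i)

      toℕ-first : ∀ i → toℕ (first i) ≡ toℕ i * (2 * K)
      toℕ-first i = toℕ-fromℕ< (first<n i)

      suc-toℕ-last : ∀ i → suc (toℕ (last i)) ≡ suc (toℕ i) * (2 * K)
      suc-toℕ-last i = cong suc (toℕ-fromℕ< (block≤n i))

      last-first : ∀ i → suc (toℕ (last i)) ≡ toℕ (first i) + 2 * K
      last-first i = begin
        suc (toℕ (last i))         ≡⟨ suc-toℕ-last i ⟩
        2 * K + toℕ i * (2 * K)   ≡⟨ ℕ.+-comm (2 * K) _ ⟩
        toℕ i * (2 * K) + 2 * K   ≡⟨ cong (_+ 2 * K) (toℕ-first i) ⟨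
        toℕ (first i) + 2 * K     ∎
        where open ≡-Reasoning

      first≤last : ∀ i → first i Fin.≤ last i
      first≤last i = s≤s⁻¹ (subst (suc (toℕ (first i)) ≤_) (sym (last-first i)) (ℕ.m<m+n _ z<s))

      block : Vec Bool m → Fin m → List Color
      block v i = range (sequence n v) (first i) (last i)

      block-applyUpTo : ∀ v i → block v i ≡ applyUpTo (color v ∘ (toℕ (first i) +_)) (2 * K)
      block-applyUpTo v i = range-tabulate (color v) (first i) (last i) (2 * K) (last-first i)

      K≤maxFrequency : ∀ (v : Vec Bool m) (i : Fin m) → K ≤ maxFrequency (block v i)
      K≤maxFrequency v i with constantHalf v i
      ... | o , o<2 , eq = ℕ.≤-trans K≤frequency (frequency≤maxFrequency 0 (block v i))
        where
        -- The constant half of block `i` has index `toℕ i * 2 + o` and starts `o * K` positions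
        -- into the block.
        position : ∀ j → toℕ (first i) + (o * K + j) ≡ (toℕ i * 2 + o) * K + j
        position j = begin
          toℕ (first i) + (o * K + j)     ≡⟨ ℕ.+-assoc (toℕ (first i)) (o * K) j ⟨
          toℕ (first i) + o * K + j       ≡⟨ cong (λ x → x + o * K + j) (toℕ-first i) ⟩
          toℕ i * (2 * K) + o * K + j     ≡⟨ cong (λ x → x + o * K + j) (ℕ.*-assoc (toℕ i) 2 K) ⟨
          toℕ i * 2 * K + o * K + j       ≡⟨ cong (_+ j) (ℕ.*-distribʳ-+ K (toℕ i * 2) o) ⟨
          (toℕ i * 2 + o) * K + j         ∎
          where open ≡-Reasoning

        color≡0 : ∀ j → j < K → color v (toℕ (first i) + (o * K + j)) ≡ 0
        color≡0 j j<K rewrite position j | /-half (toℕ i * 2 + o) j<K | eq = refl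

        K≤frequency : K ≤ frequency 0 (block v i)
        K≤frequency rewrite block-applyUpTo v i =
          frequency-applyUpTo-≥ (color v ∘ (toℕ (first i) +_)) (o * K) K (2 * K) color≡0
            (ℕ.≤-trans (ℕ.≤-reflexive (ℕ.+-comm (o * K) K)) (ℕ.*-monoˡ-≤ K o<2))

      -- Only color 0 can occur twice in a block, so `p` lies in the constant half of block `i`. The
      -- index of that half is `toℕ p / K`, and its parity is the bit.
      frequent⇒odd : ∀ (v : Vec Bool m) (i : Fin m) p → first i Fin.≤ p → p Fin.≤ last i →
        ¬ frequency (lookup (sequence n v) p) (block v i) ≤ 1 → odd (toℕ p / K) ≡ lookup v i
      frequent⇒odd v i p a≤p p≤b frequent
        rewrite lookup∘tabulate (color v ∘ toℕ) p
        with constant v (toℕ p / K) in eq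
      ... | true  = constant⇒odd v i (toℕ p / K) lo hi eq
        where
        open ℕ.≤-Reasoning
        lo : toℕ i * 2 ≤ toℕ p / K
        lo = begin
          toℕ i * 2            ≡⟨ m*n/n≡m (toℕ i * 2) K ⟨
          toℕ i * 2 * K / K    ≤⟨ /-monoˡ-≤ K (begin
            toℕ i * 2 * K      ≡⟨ ℕ.*-assoc (toℕ i) 2 K ⟩
            toℕ i * (2 * K)    ≡⟨ toℕ-first i ⟨
            toℕ (first i)      ≤⟨ a≤p ⟩
            toℕ p              ∎) ⟩
          toℕ p / K            ∎
        hi : toℕ p / K < suc (toℕ i) * 2
        hi = m<n*o⇒m/o<n (begin-strict
          toℕ p                    <⟨ s≤s p≤b ⟩
          suc (toℕ (last i))        ≡⟨ suc-toℕ-last i ⟩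
          suc (toℕ i) * (2 * K)    ≡⟨ ℕ.*-assoc (suc (toℕ i)) 2 K ⟨
          suc (toℕ i) * 2 * K      ∎)
      -- Here the color at `p` is a successor, and `color-suc` shows that such a color determines
      -- its position.
      ... | false rewrite block-applyUpTo v i =
        contradiction (frequency-applyUpTo-unique (color v ∘ (toℕ (first i) +_)) (2 * K) λ x y cx cy →
          ℕ.+-cancelˡ-≡ (toℕ (first i)) x y
            (trans (color-suc v (toℕ (first i) + x) cx) (sym (color-suc v (toℕ (first i) + y) cy)))) frequent

-- Division, rational arithmetic and floors.

m<[1+m/n]*n : ∀ m n .{{_ : ℕ.NonZero n}} → m ℕ.< ℕ.suc (m ℕ./ n) ℕ.* n
m<[1+m/n]*n m n = begin-strict
  m                          ≡⟨ ℕ.m≡m%n+[m/n]*n m n ⟩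
  m ℕ.% n ℕ.+ m ℕ./ n ℕ.* n  <⟨ ℕ.+-monoˡ-< _ (ℕ.m%n<n m n) ⟩
  n ℕ.+ m ℕ./ n ℕ.* n        ∎
  where open ℕ.≤-Reasoning

module Rationals where
  open import Data.Rational
  open +-*-Solver

  toℚ : ℕ → ℚ
  toℚ k = ℤ.+ k / 1

  -- `toℚ k` normalises through a gcd that is stuck on a variable `k`; this form is already in
  -- lowest terms, so order and arithmetic unfold on it.
  reduced : ℕ → ℚ
  reduced k = mkℚ (ℤ.+ k) 0 (Coprime.sym (Coprime.1-coprimeTo k))

  toℚ-reduced : ∀ k → toℚ k ≡ reduced k
  toℚ-reduced k = ℚ.↥p/↧p≡p (reduced k)

  toℚ-mono-≤ : ∀ {k l} → k ℕ.≤ l → toℚ k ≤ toℚ l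
  toℚ-mono-≤ {k} {l} k≤l rewrite toℚ-reduced k | toℚ-reduced l =
    *≤* (ℤ.*-monoʳ-≤-nonNeg (ℤ.+ 1) (ℤ.+≤+ k≤l))

  toℚ-cancel-≤ : ∀ {k l} → toℚ k ≤ toℚ l → k ℕ.≤ l
  toℚ-cancel-≤ {k} {l} k≤l rewrite toℚ-reduced k | toℚ-reduced l =
    ℤ.drop‿+≤+ (ℤ.*-cancelʳ-≤-pos _ _ (ℤ.+ 1) (ℚ.drop-*≤* k≤l))

  toℚ-+ : ∀ k l → toℚ (k ℕ.+ l) ≡ toℚ k + toℚ l
  toℚ-+ k l = begin
    ℤ.+ (k ℕ.+ l) / 1
      ≡⟨ cong (_/ 1) (cong₂ ℤ._+_ (ℤ.*-identityʳ (ℤ.+ k)) (ℤ.*-identityʳ (ℤ.+ l))) ⟨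
    reduced k + reduced l
      ≡⟨ cong₂ _+_ (toℚ-reduced k) (toℚ-reduced l) ⟨
    toℚ k + toℚ l ∎
    where open ≡-Reasoning

  toℚ-* : ∀ k l → toℚ (k ℕ.* l) ≡ toℚ k * toℚ l
  toℚ-* k l = begin
    ℤ.+ (k ℕ.* l) / 1
      ≡⟨ cong (_/ 1) (ℤ.pos-* k l) ⟩
    reduced k * reduced l
      ≡⟨ cong₂ _*_ (toℚ-reduced k) (toℚ-reduced l) ⟨
    toℚ k * toℚ l ∎
    where open ≡-Reasoning

  0≤toℚ : ∀ k → 0ℚ ≤ toℚ k
  0≤toℚ k = toℚ-mono-≤ {0} {k} ℕ.z≤n

  p≤∣p∣ : ∀ p → p ≤ ∣ p ∣
  p≤∣p∣ (mkℚ (ℤ.+ n)      d c) = ℚ.≤-refl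
  p≤∣p∣ (mkℚ ℤ.-[1+ n ] d c) = ℚ.≤-trans (ℚ.nonPositive⁻¹ _) (ℚ.0≤∣p∣ (mkℚ ℤ.-[1+ n ] d c))

  ∣p-q∣≤r⇒p≤q+r : ∀ p q {r} → ∣ p - q ∣ ≤ r → p ≤ q + r
  ∣p-q∣≤r⇒p≤q+r p q {r} ∣p-q∣≤r = begin
    p            ≡⟨ solve 2 (λ p q → p := q :+ (p :- q)) refl p q ⟩
    q + (p - q)  ≤⟨ ℚ.+-monoʳ-≤ q (ℚ.≤-trans (p≤∣p∣ (p - q)) ∣p-q∣≤r) ⟩
    q + r        ∎
    where open ℚ.≤-Reasoning

  ∃-floor : ∀ p → 0ℚ ≤ p → ∃[ k ] toℚ k ≤ p × p ≤ toℚ (ℕ.suc k)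
  ∃-floor (mkℚ ℤ.-[1+ n ] d c) (*≤* ())
  ∃-floor (mkℚ (ℤ.+ n) d c) _ = k , lo , hi
    where
    k = n ℕ./ ℕ.suc d
    lo : toℚ k ≤ mkℚ (ℤ.+ n) d c
    lo rewrite toℚ-reduced k = *≤* (subst₂ ℤ._≤_ (ℤ.pos-* k (ℕ.suc d)) (sym (ℤ.*-identityʳ (ℤ.+ n)))
      (ℤ.+≤+ (ℕ.m/n*n≤m n (ℕ.suc d))))
    hi : mkℚ (ℤ.+ n) d c ≤ toℚ (ℕ.suc k)
    hi rewrite toℚ-reduced (ℕ.suc k) = *≤* (subst₂ ℤ._≤_ (sym (ℤ.*-identityʳ (ℤ.+ n))) (ℤ.pos-* (ℕ.suc k) (ℕ.suc d))
      (ℤ.+≤+ (ℕ.<⇒≤ (m<[1+m/n]*n n (ℕ.suc d)))))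

-- Choosing the half length `K` from the Cauchy sequence of `1ℝ + ε`.

module Scale where
  open import Data.Rational
  open import Defs using (ℝ; 0ℝ; seq; cauchy)
  open Rationals
  open +-*-Solver
  open ℚ.≤-Reasoning

  -- Here `y` is one fixed late term of `1ℝ + ε`, with floor `k`, and `x` is any other. One ½ pays
  -- for the drift between them, the other is the margin by which `2 + k` exceeds the ratio.
  scale-lower : ∀ x y k → x ≤ y + ½ → y ≤ toℚ (ℕ.suc k) → x + ½ ≤ toℚ (2 ℕ.+ k)
  scale-lower x y k x≤y+½ y≤1+k = begin
    x + ½                      ≤⟨ ℚ.+-monoˡ-≤ ½ x≤y+½ ⟩
    y + ½ + ½                  ≡⟨ solve 1 (λ y → y :+ con ½ :+ con ½ := con 1ℚ :+ y) refl y ⟩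
    1ℚ + y                     ≤⟨ ℚ.+-monoʳ-≤ 1ℚ y≤1+k ⟩
    toℚ 1 + toℚ (ℕ.suc k)      ≡⟨ toℚ-+ 1 (ℕ.suc k) ⟨
    toℚ (2 ℕ.+ k)              ∎

  -- The left side is `5 + 2k`, which is at most `5 + 2 (x + ½) = 6 + 2x`; the constant 8 arises by
  -- absorbing 6 into `6x`, as `x` is at least 1.
  scale-upper : ∀ x y k → 1ℚ ≤ x → y ≤ x + ½ → toℚ k ≤ y →
    toℚ (ℕ.suc (2 ℕ.* (2 ℕ.+ k))) ≤ toℚ 8 * x
  scale-upper x y k 1≤x y≤x+½ k≤y = begin
    toℚ (ℕ.suc (2 ℕ.* (2 ℕ.+ k)))
      ≡⟨ cong (toℚ ∘ ℕ.suc) (ℕ.*-distribˡ-+ 2 2 k) ⟩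
    toℚ (5 ℕ.+ 2 ℕ.* k)
      ≡⟨ toℚ-+ 5 (2 ℕ.* k) ⟩
    toℚ 5 + toℚ (2 ℕ.* k)
      ≡⟨ cong (toℚ 5 +_) (toℚ-* 2 k) ⟩
    toℚ 5 + toℚ 2 * toℚ k
      ≤⟨ ℚ.+-monoʳ-≤ (toℚ 5) (ℚ.*-monoˡ-≤-nonNeg (toℚ 2) (ℚ.≤-trans k≤y y≤x+½)) ⟩
    toℚ 5 + toℚ 2 * (x + ½)
      ≡⟨ solve 1 (λ x → con (toℚ 5) :+ con (toℚ 2) :* (x :+ con ½)
           := con (toℚ 6) :* con 1ℚ :+ con (toℚ 2) :* x) refl x ⟩
    toℚ 6 * 1ℚ + toℚ 2 * x
      ≤⟨ ℚ.+-monoˡ-≤ (toℚ 2 * x) (ℚ.*-monoˡ-≤-nonNeg (toℚ 6) 1≤x) ⟩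
    toℚ 6 * x + toℚ 2 * x
      ≡⟨ solve 1 (λ x → con (toℚ 6) :* x :+ con (toℚ 2) :* x := con (toℚ 8) :* x) refl x ⟩
    toℚ 8 * x ∎

  x+½≤K⇒K≰x+¼ : ∀ {x K} → x + ½ ≤ K → ¬ K ≤ x + ℤ.+ 1 / 4
  x+½≤K⇒K≰x+¼ {x} {K} x+½≤K K≤x+¼ = ℚ.<-irrefl refl (begin-strict
    K                ≤⟨ K≤x+¼ ⟩
    x + ℤ.+ 1 / 4    <⟨ ℚ.+-monoʳ-< x (*<* (ℤ.+<+ (ℕ.s≤s (ℕ.s≤s (ℕ.s≤s ℕ.z≤n))))) ⟩
    x + ½            ≤⟨ x+½≤K ⟩
    K                ∎)

  -- The constant 16 is 2 times 8: the 8 compares the block length `l` with the ratio, the 2 covers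
  -- rounding down to whole blocks.
  toℚ[2*[m*l]]/16≤ : ∀ {x} m l → 0ℚ ≤ x → toℚ l ≤ toℚ 8 * x →
    ℤ.+ 1 / 16 * toℚ (2 ℕ.* (m ℕ.* l)) ≤ x * toℚ m
  toℚ[2*[m*l]]/16≤ {x} m l 0≤x l≤8x = begin
    c * toℚ (2 ℕ.* (m ℕ.* l))
      ≡⟨ cong (c *_) (trans (toℚ-* 2 (m ℕ.* l)) (cong (toℚ 2 *_) (toℚ-* m l))) ⟩
    c * (toℚ 2 * (toℚ m * toℚ l))
      ≤⟨ ℚ.*-monoˡ-≤-nonNeg c (ℚ.*-monoˡ-≤-nonNeg (toℚ 2)
           (ℚ.*-monoˡ-≤-nonNeg (toℚ m) {{nonNegative (0≤toℚ m)}} l≤8x)) ⟩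
    c * (toℚ 2 * (toℚ m * (toℚ 8 * x)))
      ≡⟨ solve 2 (λ m x → con c :* (con (toℚ 2) :* (m :* (con (toℚ 8) :* x))) := x :* m) refl (toℚ m) x ⟩
    x * toℚ m ∎
    where c = ℤ.+ 1 / 16

  -- A single integer must serve all late terms. The floor is therefore taken of one rational term,
  -- and the Cauchy property carries the bounds to the others.
  scale : ∀ ε → 0ℝ Defs.< ε → ∃[ k ] ∃[ N ] ∀ n → N ℕ.≤ n →
    1ℚ + seq ε n + ½ ≤ toℚ (ℕ.suc k) ×
    toℚ (ℕ.suc (2 ℕ.* ℕ.suc k)) ≤ toℚ 8 * (1ℚ + seq ε n)
  scale ε (δ , 0<δ , A , δ≤ε) with cauchy ε ½ (ℚ.positive⁻¹ ½)
  -- The half length is the floor `k` plus 2; its predecessor is returned.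
  ... | B , close = ℕ.suc k , M , λ n M≤n →
    scale-lower (1ℚ + seq ε n) y k (near n M M≤n ℕ.≤-refl) y≤1+k ,
    scale-upper (1ℚ + seq ε n) y k (1≤1+ε n M≤n) (near M n ℕ.≤-refl M≤n) k≤y
    where
    M = A ℕ.⊔ B
    y = 1ℚ + seq ε M

    near : ∀ m n → M ℕ.≤ m → M ℕ.≤ n → 1ℚ + seq ε m ≤ 1ℚ + seq ε n + ½
    near m n M≤m M≤n = begin
      1ℚ + seq ε m         ≤⟨ ℚ.+-monoʳ-≤ 1ℚ (∣p-q∣≤r⇒p≤q+r (seq ε m) (seq ε n)
                                (close m n (ℕ.m⊔n≤o⇒n≤o A B M≤m) (ℕ.m⊔n≤o⇒n≤o A B M≤n))) ⟩
      1ℚ + (seq ε n + ½)   ≡⟨ ℚ.+-assoc 1ℚ (seq ε n) ½ ⟨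
      1ℚ + seq ε n + ½     ∎

    1≤1+ε : ∀ n → M ℕ.≤ n → 1ℚ ≤ 1ℚ + seq ε n
    1≤1+ε n M≤n = begin
      1ℚ + 0ℚ        ≤⟨ ℚ.+-monoʳ-≤ 1ℚ (ℚ.<⇒≤ 0<δ) ⟩
      1ℚ + δ         ≡⟨ cong (1ℚ +_) (ℚ.+-identityˡ δ) ⟨
      1ℚ + (0ℚ + δ)  ≤⟨ ℚ.+-monoʳ-≤ 1ℚ (δ≤ε n (ℕ.m⊔n≤o⇒m≤o A B M≤n)) ⟩
      1ℚ + seq ε n   ∎

    floored = ∃-floor y (ℚ.≤-trans (ℚ.nonNegative⁻¹ 1ℚ) (1≤1+ε M ℕ.≤-refl))
    k       = proj₁ floored
    k≤y     = proj₁ (proj₂ floored)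
    y≤1+k   = proj₂ (proj₂ floored)

-- The data structure as a code for bit vectors, and the resulting bound.

open import Defs

module LowerBound (ε : ℝ) (k N : ℕ)
  (ratio-bounds : ∀ j → N ℕ.≤ j →
    seq (1ℝ + ε) j ℚ.+ ½ ℚ.≤ Rationals.toℚ (ℕ.suc k) ×
    Rationals.toℚ (ℕ.suc (2 ℕ.* ℕ.suc k)) ℚ.≤ Rationals.toℚ 8 ℚ.* seq (1ℝ + ε) j)
  (n : ℕ) (large : fromℕ 8 * (1ℝ + ε) ≤ fromℕ n) (D : ApproxRangeModeStructure ε n) where

  open ApproxRangeModeStructure D
  open Rationals using (toℚ; toℚ-mono-≤; toℚ-cancel-≤; toℚ-+; 0≤toℚ)
  open Blocks using (odd; module Coloring)
  open Coloring k using (K; sequence; module Positions)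

  m : ℕ
  m = n ℕ./ (2 ℕ.* K)

  open Positions {m} {n} (ℕ.m/n*n≤m n (2 ℕ.* K))
    using (first; last; first≤last; K≤maxFrequency; frequent⇒odd)

  ratio : ℕ → ℚ
  ratio = seq (1ℝ + ε)

  ratio+½≤K : ∀ j → N ℕ.≤ j → ratio j ℚ.+ ½ ℚ.≤ toℚ K
  ratio+½≤K j N≤j = proj₁ (ratio-bounds j N≤j)

  1+2K≤8*ratio : ∀ j → N ℕ.≤ j → toℚ (ℕ.suc (2 ℕ.* K)) ℚ.≤ toℚ 8 ℚ.* ratio j
  1+2K≤8*ratio j N≤j = proj₂ (ratio-bounds j N≤j)

  0≤ratio : ∀ j → N ℕ.≤ j → 0ℚ ℚ.≤ ratio j
  0≤ratio j N≤j = ℚ.*-cancelˡ-≤-pos (toℚ 8)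
    (ℚ.≤-trans (0≤toℚ (ℕ.suc (2 ℕ.* K))) (1+2K≤8*ratio j N≤j))

  -- The extra unit in `ratio-bounds` pays for the slack in the order on reals: with slack 1,
  -- `large` gives `2K + 1` at most `n + 1`.
  2K≤n : 2 ℕ.* K ℕ.≤ n
  2K≤n with large 1ℚ (ℚ.positive⁻¹ 1ℚ)
  ... | N′ , 8*ratio≤n+1 = ℕ.s≤s⁻¹ (subst (ℕ.suc (2 ℕ.* K) ℕ.≤_) (ℕ.+-comm n 1)
    (toℚ-cancel-≤ {ℕ.suc (2 ℕ.* K)} {n ℕ.+ 1} (begin
    toℚ (ℕ.suc (2 ℕ.* K))    ≤⟨ 1+2K≤8*ratio j (ℕ.m≤m⊔n N N′) ⟩
    toℚ 8 ℚ.* ratio j        ≤⟨ 8*ratio≤n+1 j (ℕ.m≤n⊔m N N′) ⟩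
    toℚ n ℚ.+ 1ℚ             ≡⟨ toℚ-+ n 1 ⟨
    toℚ (n ℕ.+ 1)            ∎)))
    where
    open ℚ.≤-Reasoning
    j = N ℕ.⊔ N′

  K≤F⇒f≰1 : ∀ {F f} → K ℕ.≤ F → fromℕ F ≤ (1ℝ + ε) * fromℕ f → ¬ f ℕ.≤ 1
  -- The slack ¼ is chosen below the margin ½ between the ratio and `K`; a frequency of at most 1
  -- would put `K` within ¼ of the ratio.
  K≤F⇒f≰1 {F} {f} K≤F F≤[1+ε]*f f≤1 with F≤[1+ε]*f (ℤ.+ 1 ℚ./ 4) (ℚ.positive⁻¹ _)
  ... | N′ , F≤ratio*f+¼ = Scale.x+½≤K⇒K≰x+¼ {ratio j} {toℚ K} (ratio+½≤K j (ℕ.m≤m⊔n N N′)) (begin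
    toℚ K                                     ≤⟨ toℚ-mono-≤ {K} {F} K≤F ⟩
    toℚ F                                     ≤⟨ F≤ratio*f+¼ j (ℕ.m≤n⊔m N N′) ⟩
    ratio j ℚ.* toℚ f ℚ.+ ℤ.+ 1 ℚ./ 4         ≤⟨ ℚ.+-monoˡ-≤ (ℤ.+ 1 ℚ./ 4) ratio*f≤ratio ⟩
    ratio j ℚ.+ ℤ.+ 1 ℚ./ 4                   ∎)
    where
    open ℚ.≤-Reasoning
    j = N ℕ.⊔ N′
    ratio*f≤ratio : ratio j ℚ.* toℚ f ℚ.≤ ratio j
    ratio*f≤ratio = begin
      ratio j ℚ.* toℚ f  ≤⟨ ℚ.*-monoˡ-≤-nonNeg (ratio j) {{ℚ.nonNegative (0≤ratio j (ℕ.m≤m⊔n N N′))}} (toℚ-mono-≤ {f} {1} f≤1) ⟩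
      ratio j ℚ.* 1ℚ     ≡⟨ ℚ.*-identityʳ (ratio j) ⟩
      ratio j            ∎

  enc : Vec Bool m → List Bool
  enc v = encode (sequence n v)

  -- The answer to the query on a block lies in the constant half, whose parity is the bit. Only the
  -- encoding is consulted.
  dec : List Bool → Vec Bool m
  dec s = tabulate λ i → odd (toℕ (query s (first i) (last i)) ℕ./ K)

  dec∘enc : ∀ v → dec (enc v) ≡ v
  dec∘enc v = trans (tabulate-cong bit) (tabulate∘lookup v)
    where
    bit : ∀ i → odd (toℕ (query (enc v) (first i) (last i)) ℕ./ K) ≡ lookup v i
    bit i = frequent⇒odd v i _ lower upper (K≤F⇒f≰1 (K≤maxFrequency v i) approx)
      where open IsApproxMode (correct (sequence n v) (first i) (last i) (first≤last i))

  -- Since at least one block fits, rounding `n` down to whole blocks loses less than a factor 2.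
  n≤2*[m*2K] : n ℕ.≤ 2 ℕ.* (m ℕ.* (2 ℕ.* K))
  n≤2*[m*2K] = begin
    n                          <⟨ m<[1+m/n]*n n (2 ℕ.* K) ⟩
    ℕ.suc m ℕ.* (2 ℕ.* K)      ≤⟨ ℕ.*-monoˡ-≤ (2 ℕ.* K) 1+m≤2*m ⟩
    2 ℕ.* m ℕ.* (2 ℕ.* K)      ≡⟨ ℕ.*-assoc 2 m (2 ℕ.* K) ⟩
    2 ℕ.* (m ℕ.* (2 ℕ.* K))    ∎
    where
    open ℕ.≤-Reasoning
    1+m≤2*m : ℕ.suc m ℕ.≤ 2 ℕ.* m
    1+m≤2*m = ℕ.+-mono-≤ (ℕ.m≥n⇒m/n>0 2K≤n) (ℕ.m≤m+n m 0)

  space-bound : ∃[ cs ] fromℚ (ℤ.+ 1 ℚ./ 16) * fromℕ n ≤ (1ℝ + ε) * fromℕ (spaceFor cs)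
  space-bound = let v , m≤space = Incompressibility.incompressible enc dec dec∘enc in
    -- Every term from `N` on satisfies the inequality without slack, so the same `N` serves all
    -- `δ`.
    sequence n v , λ δ 0<δ → N , λ j N≤j → begin
    ℤ.+ 1 ℚ./ 16 ℚ.* toℚ n
      ≤⟨ ℚ.*-monoˡ-≤-nonNeg (ℤ.+ 1 ℚ./ 16) (toℚ-mono-≤ {n} {2 ℕ.* (m ℕ.* (2 ℕ.* K))} n≤2*[m*2K]) ⟩
    ℤ.+ 1 ℚ./ 16 ℚ.* toℚ (2 ℕ.* (m ℕ.* (2 ℕ.* K)))
      ≤⟨ Scale.toℚ[2*[m*l]]/16≤ {ratio j} m (2 ℕ.* K) (0≤ratio j N≤j)
           (ℚ.≤-trans (toℚ-mono-≤ {2 ℕ.* K} {ℕ.suc (2 ℕ.* K)} (ℕ.n≤1+n (2 ℕ.* K))) (1+2K≤8*ratio j N≤j)) ⟩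
    ratio j ℚ.* toℚ m
      ≤⟨ ℚ.*-monoˡ-≤-nonNeg (ratio j) {{ℚ.nonNegative (0≤ratio j N≤j)}} (toℚ-mono-≤ {m} {spaceFor (sequence n v)} m≤space) ⟩
    ratio j ℚ.* toℚ (spaceFor (sequence n v))
      ≡⟨ ℚ.+-identityʳ (ratio j ℚ.* toℚ (spaceFor (sequence n v))) ⟨
    ratio j ℚ.* toℚ (spaceFor (sequence n v)) ℚ.+ 0ℚ
      ≤⟨ ℚ.+-monoʳ-≤ (ratio j ℚ.* toℚ (spaceFor (sequence n v))) (ℚ.<⇒≤ 0<δ) ⟩
    ratio j ℚ.* toℚ (spaceFor (sequence n v)) ℚ.+ δ ∎
    where open ℚ.≤-Reasoning

theorem1 : ∃[ c ] 0ℝ < c × (∃[ N₀ ] (∀ (ε : ℝ) → 0ℝ < ε → ∀ (n : ℕ) →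
    N₀ * (1ℝ + ε) ≤ fromℕ n →
    (D : ApproxRangeModeStructure ε n) →
    ∃[ cs ] c * fromℕ n ≤ (1ℝ + ε) * fromℕ (ApproxRangeModeStructure.spaceFor D cs)))
theorem1 = fromℚ c
         , (c , ℚ.positive⁻¹ c , 0 , λ _ _ → ℚ.≤-refl)
         -- With `n` at least 8 times `1ℝ + ε`, one full block fits.
         , fromℕ 8
         , λ ε 0<ε → let k , N , ratio-bounds = Scale.scale ε 0<ε in LowerBound.space-bound ε k N ratio-bounds
  where c = ℤ.+ 1 ℚ./ 16
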